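{- There is an absolute constant $c>0$ such that every acyclic graph $G$ of order $n$ satisfies $\operatorname{bdim}(G)\ge c\sqrt{n}$, i.e. $\operatorname{bdim}(G)=\Omega(\sqrt n)$. Moreover this lower bound is asymptotically optimal: there is a family of acyclic graphs $G$ whose orders $n$ tend to infinity and which satisfy $\operatorname{bdim}(G)=O(\sqrt{n})$.
   Context: All graphs are finite, simple and undirected. For vertices $u,v$ of a graph $G$, $d(u,v)=d_G(u,v)$ is the length of a shortest $u$–$v$ path if $u,v$ lie in the same component, and $\infty$ otherwise. For a positive integer $k$, $d_k(u,v)=\min\{d(u,v),k+1\}$. A function $f:V(G)\to\mathbb{Z}_{\ge 0}$ is a resolving broadcast of $G$ if for any distinct $x,y\in V(G)$ there is a vertex $z$ with $f(z)>0$ and $d_{f(z)}(x,z)\neq d_{f(z)}(y,z)$. The broadcast dimension $\operatorname{bdim}(G)$ is the minimum of $\sum_{v\in V(G)} f(v)$ over all resolving broadcasts $f$ of $G$.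
   Formalization: The lower bound is proved for acyclic graphs of order n at least 2; the one-vertex graph has broadcast dimension 0, so the inequality with c > 0 fails for n = 1. -}

module Defs where

open import Data.Nat using (ℕ; zero; suc; _+_; _*_; _≤_; _<_)
open import Data.Fin using (Fin; inject₁; fromℕ) renaming (zero to fz; suc to fs)
open import Data.Bool using (Bool; true; false)
open import Data.List using (List; map; allFin)
open import Data.Nat.ListAction using (sum)
open import Data.Product using (Σ; _×_; _,_)
open import Data.Sum using (_⊎_)
open import Relation.Binary.PropositionalEquality using (_≡_; _≢_)
open import Relation.Nullary using (¬_)
open import Function.Definitions using (Injective)

record SimpleGraph (n : ℕ) : Set where
  field
    adj    : Fin n → Fin n → Bool
    sym    : ∀ u v → adj u v ≡ adj v u
    irrefl : ∀ v → adj v v ≡ false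
open SimpleGraph public

HasCycle : ∀ {n} → SimpleGraph n → Set
HasCycle {n} G =
  Σ ℕ λ m → Σ (Fin (suc (suc (suc m))) → Fin n) λ c →
    Injective _≡_ _≡_ c
    × (∀ (i : Fin (suc (suc m))) → adj G (c (inject₁ i)) (c (fs i)) ≡ true)
    × (adj G (c (fromℕ (suc (suc m)))) (c fz) ≡ true)

Acyclic : ∀ {n} → SimpleGraph n → Set
Acyclic G = ¬ HasCycle G

data Walk {n} (G : SimpleGraph n) : Fin n → Fin n → ℕ → Set where
  here : ∀ {u} → Walk G u u 0
  step : ∀ {u w v ℓ} → adj G u w ≡ true → Walk G w v ℓ → Walk G u v (suc ℓ)

-- Dk G k x z a  means  d_k(x,z) = min{d(x,z), k+1} = a.
-- (d(x,z) is the least length of a walk from x to z, ∞ if none.)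
Dk : ∀ {n} → SimpleGraph n → ℕ → Fin n → Fin n → ℕ → Set
Dk G k x z a =
    (a ≤ k × Walk G x z a × (∀ b → b < a → ¬ Walk G x z b))
  ⊎ (a ≡ suc k × (∀ b → b ≤ k → ¬ Walk G x z b))

Broadcast : ℕ → Set
Broadcast n = Fin n → ℕ

cost : ∀ {n} → Broadcast n → ℕ
cost {n} f = sum (map f (allFin n))

Resolving : ∀ {n} → SimpleGraph n → Broadcast n → Set
Resolving {n} G f =
  ∀ (x y : Fin n) → x ≢ y →
    Σ (Fin n) λ z → 0 < f z × Σ ℕ λ a → Σ ℕ λ b →
      a ≢ b × Dk G (f z) x z a × Dk G (f z) y z b

IsBdim : ∀ {n} → SimpleGraph n → ℕ → Set
IsBdim {n} G b =
  (Σ (Broadcast n) λ f → Resolving G f × cost f ≡ b)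
  × (∀ (f : Broadcast n) → Resolving G f → b ≤ cost f)

{-# OPTIONS --safe #-}
{-
Lower bound.  Let f be a resolving broadcast of cost b on a forest, and say that
y reaches x if f y > 0 and d(x,y) ≤ f y.  At most one vertex is not reached by
any landmark.  For a reached x choose some z reaching x and, among the y reaching
x, one that maximises the Gromov product of x and y at z, i.e. d(y,z) − d(x,y).
By the four-point condition for trees, two vertices sharing
(z, d(x,z), y, d(x,y)) are not distinguished by any landmark, so this quadruple
determines x.  There are at most Σ (f z + 1) ≤ 2b pairs (z, d(x,z)), hence at
most 1 + (2b)² ≤ 5b² vertices.

Upper bound.  Take a comb with L teeth of L vertices each.  The distances to the
two ends of the spine determine a vertex, and a value 2L at both ends reaches
everything, at cost 4L for L² vertices.
-}
module Submission where

open import Defs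
open import Data.Bool using (true; _∨_)
import Data.Bool.Properties as Bool
open import Data.Fin using (Fin; inject₁; fromℕ; fromℕ<; toℕ; _↑ˡ_; _↑ʳ_; splitAt; combine; remQuot)
  renaming (zero to fz; suc to fs)
open import Data.Fin.Properties
  using (any?; all?; toℕ<n; toℕ-inject₁; toℕ-injective; toℕ-fromℕ<; fromℕ<-injective;
         ↑ˡ-injective; ↑ʳ-injective; splitAt-↑ˡ; splitAt-↑ʳ; remQuot-combine; combine-remQuot;
         combine-injective; injective⇒≤)
  renaming (_≟_ to _≟ᶠ_; suc-injective to fs-injective)
open import Data.Fin.Relation.Unary.Top using (View; ‵fromℕ; ‵inj₁; view; view-fromℕ; view-inject₁)
open import Data.List using (tabulate; allFin)
open import Data.List.Properties using (map-tabulate; map-cong)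
open import Data.Nat using (ℕ; zero; suc; _+_; _*_; _∸_; _≤_; _<_; z≤n; s≤s; s≤s⁻¹)
open import Data.Nat.ListAction using (sum)
open import Data.Nat.Properties
open import Data.Nat.Tactic.RingSolver using (solve-∀)
open import Data.Product using (Σ; ∃; _×_; _,_; proj₁; proj₂; uncurry)
open import Data.Sum using (_⊎_; inj₁; inj₂; [_,_]′)
open import Data.Vec.Functional using (_∷_; head; tail; updateAt)
open import Function using (_∘_; id)
open import Function.Definitions using (Injective)
open import Relation.Binary.PropositionalEquality
  using (_≡_; _≢_; _≗_; refl; trans; cong; cong₂; subst; subst₂; module ≡-Reasoning)
  renaming (sym to ≡-sym)
open import Relation.Nullary using (¬_; Dec; yes; no; does; contradiction; _×-dec_; _→-dec_; ¬?)
open import Relation.Nullary.Decidable using (map′; dec-true; dec-false)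

-- Least natural numbers with a decidable property

search : ∀ {P : ℕ → Set} → (∀ k → Dec (P k)) → ∀ k →
  (∃ λ m → m < k × P m × (∀ j → j < m → ¬ P j)) ⊎ (∀ j → j < k → ¬ P j)
search P? zero = inj₂ λ _ ()
search P? (suc k) with search P? k | P? k
... | inj₁ (m , m<k , least) | _      = inj₁ (m , m<n⇒m<1+n m<k , least)
... | inj₂ none              | yes pk = inj₁ (k , ≤-refl , pk , none)
... | inj₂ none              | no ¬pk = inj₂ λ j j<1+k pj → below j (s≤s⁻¹ j<1+k) pj
  where
  below : ∀ j → j ≤ k → ¬ _
  below j j≤k pj with m≤n⇒m<n∨m≡n j≤k
  ... | inj₁ j<k  = none j j<k pj
  ... | inj₂ refl = ¬pk pj

least : ∀ {P : ℕ → Set} → (∀ k → Dec (P k)) → ∀ k → P k →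
  ∃ λ m → m ≤ k × P m × (∀ j → P j → m ≤ j)
least P? k pk with search P? (suc k)
... | inj₁ (m , m<1+k , pm , none) = m , s≤s⁻¹ m<1+k , pm , λ j pj → ≮⇒≥ λ j<m → none j j<m pj
... | inj₂ none = contradiction pk (none k ≤-refl)

-- Walks and distances

module _ {n} (G : SimpleGraph n) where

  Walk? : ∀ u v ℓ → Dec (Walk G u v ℓ)
  Walk? u v zero = map′ (λ { refl → here }) (λ { here → refl }) (u ≟ᶠ v)
  Walk? u v (suc ℓ) =
    map′ (λ (_ , e , W) → step e W) (λ { (step e W) → _ , e , W })
      (any? λ w → (adj G u w Bool.≟ true) ×-dec Walk? w v ℓ)

  ¬loop : ∀ {v} → adj G v v ≢ true
  ¬loop {v} e with trans (≡-sym e) (irrefl G v)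
  ... | ()

  adj-sym : ∀ {u v} → adj G u v ≡ true → adj G v u ≡ true
  adj-sym {u} {v} e = trans (≡-sym (sym G u v)) e

module _ {n} {G : SimpleGraph n} where

  infixr 5 _++_
  _++_ : ∀ {u v w a b} → Walk G u v a → Walk G v w b → Walk G u w (a + b)
  here     ++ W′ = W′
  step e W ++ W′ = step e (W ++ W′)

  reverse : ∀ {u v a} → Walk G u v a → Walk G v u a
  reverse here = here
  reverse (step {ℓ = ℓ} e W) =
    subst (Walk G _ _) (+-comm ℓ 1) (reverse W ++ step (adj-sym G e) here)

Dist : ∀ {n} → SimpleGraph n → Fin n → Fin n → ℕ → Set
Dist G u v d = Walk G u v d × (∀ e → Walk G u v e → d ≤ e)

dist : ∀ {n} (G : SimpleGraph n) {u v k} → Walk G u v k → ∃ λ d → d ≤ k × Dist G u v d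
dist G {u} {v} {k} W = least (Walk? G u v) k W

module _ {n} {G : SimpleGraph n} where

  Dist-unique : ∀ {u v d e} → Dist G u v d → Dist G u v e → d ≡ e
  Dist-unique (W , m) (W′ , m′) = ≤-antisym (m _ W′) (m′ _ W)

  Dist-tail : ∀ {u w v d} → adj G u w ≡ true → Walk G w v d → Dist G u v (suc d) → Dist G w v d
  Dist-tail e W (_ , m) = W , λ k W′ → s≤s⁻¹ (m (suc k) (step e W′))

-- Simple paths and their closure to cycles

record SimplePath {n} (G : SimpleGraph n) (m : ℕ) (p q : Fin n) : Set where
  field
    vertex    : Fin (suc m) → Fin n
    injective : Injective _≡_ _≡_ vertex
    linked    : ∀ (i : Fin m) → adj G (vertex (inject₁ i)) (vertex (fs i)) ≡ true
    source    : vertex fz ≡ p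
    target    : vertex (fromℕ m) ≡ q
open SimplePath

module _ {n} {G : SimpleGraph n} where

  single : ∀ p → SimplePath G 0 p p
  single p .vertex _ = p
  single p .injective {fz} {fz} _ = refl
  single p .linked ()
  single p .source = refl
  single p .target = refl

  cons : ∀ {m u p q} (c : SimplePath G m p q) → adj G u p ≡ true →
    (∀ i → vertex c i ≢ u) → SimplePath G (suc m) u q
  cons {u = u} c e new .vertex fz     = u
  cons         c e new .vertex (fs i) = vertex c i
  cons c e new .injective {fz}   {fz}   _  = refl
  cons c e new .injective {fz}   {fs j} eq = contradiction (≡-sym eq) (new j)
  cons c e new .injective {fs i} {fz}   eq = contradiction eq (new i)
  cons c e new .injective {fs i} {fs j} eq = cong fs (injective c eq)
  cons c e new .linked fz     = subst (λ p → adj G _ p ≡ true) (≡-sym (source c)) e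
  cons c e new .linked (fs i) = linked c i
  cons c e new .source = refl
  cons c e new .target = target c

  snoc-vertex : ∀ {m} → (Fin (suc m) → Fin n) → Fin n → ∀ {i : Fin (2 + m)} → View i → Fin n
  snoc-vertex c x ‵fromℕ         = x
  snoc-vertex c x (‵inj₁ {i = j} _) = c j

  snoc : ∀ {m p q u} (c : SimplePath G m p q) → adj G q u ≡ true →
    (∀ i → vertex c i ≢ u) → SimplePath G (suc m) p u
  snoc {u = u} c e new .vertex i = snoc-vertex (vertex c) u (view i)
  snoc {u = u} c e new .injective {i} {j} = inj (view i) (view j)
    where
    inj : ∀ {i j} (v : View i) (w : View j) →
      snoc-vertex (vertex c) u v ≡ snoc-vertex (vertex c) u w → i ≡ j
    inj ‵fromℕ ‵fromℕ _ = refl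
    inj ‵fromℕ (‵inj₁ _) eq = contradiction (≡-sym eq) (new _)
    inj (‵inj₁ _) ‵fromℕ eq = contradiction eq (new _)
    inj (‵inj₁ _) (‵inj₁ _) eq = cong inject₁ (injective c eq)
  snoc {m} {u = u} c e new .linked i rewrite view-inject₁ i with view i
  ... | ‵fromℕ = subst (λ q → adj G q u ≡ true) (≡-sym (target c)) e
  ... | ‵inj₁ {i = j} _ = linked c j
  snoc c e new .source = source c
  snoc {m} c e new .target rewrite view-fromℕ m = refl

  -- Two edges or more give the three vertices or more that `HasCycle` asks for.
  close : ∀ {m p q} → SimplePath G (2 + m) p q → adj G q p ≡ true → HasCycle G
  close {m} c e = m , vertex c , injective c , linked c ,
    subst₂ (λ q p → adj G q p ≡ true) (≡-sym (target c)) (≡-sym (source c)) e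

  snoc-all : ∀ {m p q u} (P : Fin n → Set) (c : SimplePath G m p q) (e : adj G q u ≡ true)
    (new : ∀ i → vertex c i ≢ u) → (∀ i → P (vertex c i)) → P u → ∀ i → P (vertex (snoc c e new) i)
  snoc-all {u = u} P c e new all pu i with view i
  ... | ‵fromℕ = pu
  ... | ‵inj₁ {i = j} _ = all j

-- Levels, ancestors and the four-point condition in a forest

module Rooted {n} (G : SimpleGraph n) (acyclic : Acyclic G) (z : Fin n) where

  Within : ℕ → Fin n → Set
  Within i v = ∃ λ j → j ≤ i × Walk G v z j

  Within-suc : ∀ {i v} → Within i v → Within (suc i) v
  Within-suc (j , j≤i , W) = j , m≤n⇒m≤1+n j≤i , W

  outside : ∀ {i v w} → Dist G v z (suc i) → Within i w → w ≢ v
  outside (_ , m) (j , j≤i , W) refl = <⇒≱ (m j W) j≤i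

  -- The distinct ends `p` and `q` lie at level `suc i` while `c` stays within level `i`, so neither
  -- occurs on `c` and the longer vertex sequence is still injective.
  enclose : ∀ {i m p p′ q q′} → Dist G p z (suc i) → Dist G q z (suc i) → p ≢ q →
    adj G p p′ ≡ true → adj G q q′ ≡ true →
    (c : SimplePath G m p′ q′) → (∀ k → Within i (vertex c k)) →
    Σ (SimplePath G (2 + m) p q) λ c → ∀ k → Within (suc i) (vertex c k)
  enclose {i} {p = p} {q = q} {q′} P Q p≢q e e′ c below =
    snoc c′ (adj-sym G e′) new ,
    snoc-all (Within (suc i)) c′ (adj-sym G e′) new below′ (_ , ≤-refl , proj₁ Q)
    where
    c′ : SimplePath G _ p q′
    c′ = cons c e λ k → outside P (below k)
    new : ∀ k → vertex c′ k ≢ q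
    new fz     = p≢q
    new (fs k) = outside Q (below k)
    below′ : ∀ k → Within (suc i) (vertex c′ k)
    below′ fz     = suc i , ≤-refl , proj₁ P
    below′ (fs k) = Within-suc (below k)

  -- Descend from p and q towards z until the two descents meet.
  arc : ∀ i {p q} → Dist G p z i → Dist G q z i →
    p ≡ q ⊎ ∃ λ m → Σ (SimplePath G (2 + m) p q) λ c → ∀ k → Within i (vertex c k)
  arc zero (here , _) (here , _) = inj₁ refl
  arc (suc i) {p} {q} P@(step {w = p′} e V , _) Q@(step {w = q′} e′ W , _) with p ≟ᶠ q
  ... | yes p≡q = inj₁ p≡q
  ... | no p≢q with arc i (Dist-tail e V P) (Dist-tail e′ W Q)
  ...   | inj₁ refl = inj₂ (0 , enclose P Q p≢q e e′ (single p′) λ _ → i , ≤-refl , V)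
  ...   | inj₂ (m , c , below) = inj₂ (2 + m , enclose P Q p≢q e e′ c below)

  -- Otherwise `arc` joins `u` to `v` by a path with at least two edges, and the edge between them
  -- closes it to a cycle.
  levels-differ : ∀ {i u v} → adj G u v ≡ true → Dist G u z i → ¬ Dist G v z i
  levels-differ {i} e U V with arc i U V
  ... | inj₁ refl        = ¬loop G e
  ... | inj₂ (m , c , _) = acyclic (close c (adj-sym G e))

  -- For `v ≢ w`, the path given by `arc` stays within level `i`, hence avoids `u`, and the two
  -- edges at `u` close it to a cycle.
  parent-unique : ∀ {i u v w} → Dist G u z (suc i) → adj G u v ≡ true → adj G u w ≡ true →
    Dist G v z i → Dist G w z i → v ≡ w
  parent-unique {i} U e e′ V W with arc i V W
  ... | inj₁ v≡w = v≡w
  ... | inj₂ (m , c , below) =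
    contradiction (close (cons c e λ k → outside U (below k)) (adj-sym G e′)) acyclic

  adjacent-levels : ∀ {u v i j} → adj G u v ≡ true → Dist G u z i → Dist G v z j →
    i ≡ suc j ⊎ j ≡ suc i
  adjacent-levels {i = i} {j} e U@(W , m) V@(W′ , m′)
    with m≤n⇒m<n∨m≡n (m (suc j) (step e W′))
       | m≤n⇒m<n∨m≡n (m′ (suc i) (step (adj-sym G e) W))
  ... | inj₂ eq   | _         = inj₁ eq
  ... | _         | inj₂ eq   = inj₂ eq
  ... | inj₁ i<1+j | inj₁ j<1+i with ≤-antisym (s≤s⁻¹ i<1+j) (s≤s⁻¹ j<1+i)
  ...   | refl = contradiction V (levels-differ e U)

  infix 4 _⇓[_]_
  -- The ancestor relation of the component rooted at `z`. Each edge carries the levels of its ends,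
  -- which is what `parent-unique` consumes.
  data _⇓[_]_ : Fin n → ℕ → Fin n → Set where
    stop : ∀ {u} → u ⇓[ 0 ] u
    down : ∀ {u v w i j} → adj G u v ≡ true → Dist G u z (suc i) → Dist G v z i →
      v ⇓[ j ] w → u ⇓[ suc j ] w

  ⇓-walk : ∀ {u v j} → u ⇓[ j ] v → Walk G u v j
  ⇓-walk stop           = here
  ⇓-walk (down e _ _ D) = step e (⇓-walk D)

  ⇓-level : ∀ {u v j i} → Dist G u z i → u ⇓[ j ] v → ∃ λ k → i ≡ j + k × Dist G v z k
  ⇓-level U stop = _ , refl , U
  ⇓-level U (down e U′ V D) with ⇓-level V D
  ... | k , refl , W = k , Dist-unique U U′ , W

  ⇓-snoc : ∀ {u v w j i} → u ⇓[ j ] v → adj G v w ≡ true → Dist G v z (suc i) → Dist G w z i →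
    u ⇓[ suc j ] w
  ⇓-snoc stop            e′ V′ W = down e′ V′ W stop
  ⇓-snoc (down e U V D) e′ V′ W = down e U V (⇓-snoc D e′ V′ W)

  -- By `parent-unique`, the shorter descent is an initial segment of the longer one.
  ⇓-split : ∀ {u v w j k} → u ⇓[ j ] v → u ⇓[ j + k ] w → v ⇓[ k ] w
  ⇓-split stop E = E
  ⇓-split (down e U V D) (down e′ U′ V′ E) with Dist-unique U U′
  ... | refl with parent-unique U e e′ V V′
  ...   | refl = ⇓-split D E

  -- Induction on the walk. A first edge towards `z` extends the descent of `a`. A first edge away
  -- from `z` leads from the parent of `w` to `w`: it cancels the first edge of a nonempty descent
  -- of `w`, and otherwise the descent of `c`, which ends at `w`, is prolonged to `a`.
  meet : ∀ {a c s k} → Walk G a c s → Walk G c z k →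
    ∃ λ m → ∃ λ i → ∃ λ j → a ⇓[ i ] m × c ⇓[ j ] m × i + j ≤ s
  meet here C = _ , 0 , 0 , stop , stop , z≤n
  meet (step e W) C with meet W C | dist G (step e W ++ C) | dist G (W ++ C)
  ... | m , i , j , I , J , i+j≤s | _ , _ , A | _ , _ , B with adjacent-levels e A B | I
  ...   | inj₁ refl | I′ = m , suc i , j , down e A B I′ , J , s≤s i+j≤s
  ...   | inj₂ refl | stop =
    _ , 0 , suc j , stop , ⇓-snoc J (adj-sym G e) B A , s≤s i+j≤s
  ...   | inj₂ refl | down {j = i′} e′ B′ A′ I′ with Dist-unique B B′
  ...     | refl with parent-unique B (adj-sym G e) e′ A A′
  ...       | refl = m , i′ , j , I′ , J , m≤n⇒m≤1+n (≤-trans (n≤1+n _) i+j≤s)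

  -- The case of four-point where the meeting vertex m′ of b and c is at least
  -- as far from z as the meeting vertex m of a and c.
  four-point-below : ∀ {a b c m m′ i j j′ k s β γ} → Dist G b z β → Dist G c z γ →
    a ⇓[ i ] m → c ⇓[ j ] m → c ⇓[ j′ ] m′ → b ⇓[ k ] m′ → j′ ≤ j → i + j ≤ s →
    ∃ λ r → Walk G a b r × r + γ ≤ s + β
  four-point-below {i = i} {j′ = j′} {k} {s} B C I J J′ K j′≤j i+j≤s with m≤n⇒∃[o]m+o≡n j′≤j
  ... | e , refl with ⇓-level C J′ | ⇓-level B K
  ...   | l , refl , M | l′ , refl , M′ with Dist-unique M M′
  ...     | refl =
    -- The walk goes from `a` to `m`, then to `m′`, then to `b`. With `l` the level of `m′`, the
    -- level of `c` is `j′ + l` and that of `b` is `k + l`.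
    i + (e + k) ,
    ⇓-walk I ++ reverse (⇓-walk (⇓-split J′ J)) ++ reverse (⇓-walk K) ,
    subst (_≤ s + (k + l)) (arith i e k j′ l) (+-monoˡ-≤ (k + l) i+j≤s)
    where
    arith : ∀ i e k j l → i + (j + e) + (k + l) ≡ i + (e + k) + (j + l)
    arith = solve-∀

  -- The four-point condition, with the maximum written as a disjunction. Both meeting vertices lie
  -- on the descent from `c` to `z`, so one is an ancestor of the other; the two cases differ by
  -- exchanging `a` and `b`.
  four-point : ∀ {a b c α β γ s t} → Dist G a z α → Dist G b z β → Dist G c z γ →
    Walk G a c s → Walk G c b t → ∃ λ r → Walk G a b r × (r + γ ≤ s + β ⊎ r + γ ≤ t + α)
  four-point A B C V W with meet V (proj₁ C) | meet (reverse W) (proj₁ C)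
  ... | _ , i , j , I , J , i+j≤s | _ , k , j′ , K , J′ , k+j′≤t with ≤-total j′ j
  ...   | inj₁ j′≤j with four-point-below B C I J J′ K j′≤j i+j≤s
  ...     | r , U , le = r , U , inj₁ le
  four-point A B C V W | _ , i , j , I , J , i+j≤s | _ , k , j′ , K , J′ , k+j′≤t | inj₂ j≤j′
    with four-point-below A C K J′ J I j≤j′ k+j′≤t
  ...     | r , U , le = r , reverse U , inj₂ le

-- Truncated distances

module _ {n} (G : SimpleGraph n) where

  Dk-total : ∀ k x z → ∃ (Dk G k x z)
  Dk-total k x z with search (Walk? G x z) (suc k)
  ... | inj₁ (d , d<1+k , W , minimal) = d , inj₁ (s≤s⁻¹ d<1+k , W , minimal)
  ... | inj₂ none = suc k , inj₂ (refl , λ b b≤k → none b (s≤s b≤k))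

  Dk-unique : ∀ {k x z a b} → Dk G k x z a → Dk G k x z b → a ≡ b
  Dk-unique (inj₁ (_ , W , m)) (inj₁ (_ , W′ , m′)) =
    ≤-antisym (≮⇒≥ λ b<a → m _ b<a W′) (≮⇒≥ λ a<b → m′ _ a<b W)
  Dk-unique (inj₁ (a≤k , W , _)) (inj₂ (_ , none)) = contradiction W (none _ a≤k)
  Dk-unique (inj₂ (_ , none)) (inj₁ (b≤k , W , _)) = contradiction W (none _ b≤k)
  Dk-unique (inj₂ (refl , _)) (inj₂ (refl , _)) = refl

-- Maxima over a finite index set

argmax : ∀ {n} {P : Fin n → ℕ → Set} →
  (∀ i → (∃ λ k → P i k × ∀ l → P i l → l ≤ k) ⊎ (∀ k → ¬ P i k)) →
  (∃ λ i → ∃ λ k → P i k × ∀ j l → P j l → l ≤ k) ⊎ (∀ i k → ¬ P i k)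
argmax {zero} best = inj₂ λ ()
argmax {suc n} best with best fz | argmax (best ∘ fs)
... | inj₂ none | inj₂ none′ = inj₂ λ { fz → none ; (fs i) → none′ i }
... | inj₁ (k , p , max) | inj₂ none′ =
  inj₁ (fz , k , p , λ { fz → max ; (fs i) l q → contradiction q (none′ i l) })
... | inj₂ none | inj₁ (i , k , p , max) =
  inj₁ (fs i , k , p , λ { fz l q → contradiction q (none l) ; (fs i) → max i })
... | inj₁ (k , p , max) | inj₁ (i , k′ , p′ , max′) with ≤-total k k′
...   | inj₁ k≤k′ = inj₁ (fs i , k′ , p′ , λ { fz l q → ≤-trans (max l q) k≤k′ ; (fs i) → max′ i })
...   | inj₂ k′≤k = inj₁ (fz , k , p , λ { fz → max ; (fs i) l q → ≤-trans (max′ i l q) k′≤k })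

-- Numbering the pairs `(y , t)` with `t < g y` in consecutive blocks

tag : ∀ {n} (g : Fin n → ℕ) y {t} → t < g y → Fin (sum (tabulate g))
tag g fz     t<g = fromℕ< t<g ↑ˡ _
tag g (fs y) t<g = g fz ↑ʳ tag (g ∘ fs) y t<g

↑ˡ≢↑ʳ : ∀ {m n} (i : Fin m) (j : Fin n) → i ↑ˡ n ≢ m ↑ʳ j
↑ˡ≢↑ʳ {m} {n} i j eq
  with trans (≡-sym (splitAt-↑ˡ m i n)) (trans (cong (splitAt m) eq) (splitAt-↑ʳ m n j))
... | ()

tag-injective : ∀ {n} (g : Fin n → ℕ) y y′ {t t′} {t<g : t < g y} {t′<g : t′ < g y′} →
  tag g y t<g ≡ tag g y′ t′<g → y ≡ y′ × t ≡ t′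
tag-injective g fz fz eq = refl , fromℕ<-injective _ _ _ _ (↑ˡ-injective _ _ _ eq)
tag-injective g fz (fs y′) eq = contradiction eq (↑ˡ≢↑ʳ _ _)
tag-injective g (fs y) fz eq = contradiction (≡-sym eq) (↑ˡ≢↑ʳ _ _)
tag-injective g (fs y) (fs y′) eq with tag-injective (g ∘ fs) y y′ (↑ʳ-injective (g fz) _ _ eq)
... | refl , t≡t′ = refl , t≡t′

cost-tabulate : ∀ {n} (f : Broadcast n) → cost f ≡ sum (tabulate f)
cost-tabulate f = cong sum (map-tabulate id f)

≤-sum : ∀ {n} (f : Fin n → ℕ) y → f y ≤ sum (tabulate f)
≤-sum f fz     = m≤m+n _ _
≤-sum f (fs y) = ≤-trans (≤-sum (f ∘ fs) y) (m≤n+m _ (f fz))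

≤-cost : ∀ {n} (f : Broadcast n) y → f y ≤ cost f
≤-cost f y rewrite cost-tabulate f = ≤-sum f y

-- The number of distances 0, …, k from a vertex of value k at which the vertex
-- reaches; a vertex of value 0 reaches nothing.
slots : ℕ → ℕ
slots zero    = 0
slots (suc k) = 2 + k

<-slots : ∀ {k t} → 0 < k → t ≤ k → t < slots k
<-slots {suc k} _ t≤k = s≤s t≤k

-- A positive `k` has `k + 1` slots, at most `2 * k`. As zero has none, the total is bounded by the
-- cost alone, without a term in `n`.
slots-≤ : ∀ k → slots k ≤ 2 * k
slots-≤ zero    = z≤n
slots-≤ (suc k) = s≤s (subst (suc k ≤_) (≡-sym (+-suc k (k + 0))) (s≤s (m≤m+n k _)))

sum-slots-≤ : ∀ {n} (f : Fin n → ℕ) → sum (tabulate (slots ∘ f)) ≤ 2 * sum (tabulate f)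
sum-slots-≤ {zero} f = z≤n
sum-slots-≤ {suc n} f = ≤-trans (+-mono-≤ (slots-≤ (f fz)) (sum-slots-≤ (f ∘ fs)))
  (≤-reflexive (≡-sym (*-distribˡ-+ 2 (f fz) _)))

-- The lower bound: coding vertices by landmarks and distances

module LowerBound {n} (G : SimpleGraph n) (acyclic : Acyclic G)
  (f : Broadcast n) (resolving : Resolving G f) where

  Reach : Fin n → Fin n → ℕ → Set
  Reach x y t = 0 < f y × t ≤ f y × Dist G x y t

  reach : ∀ {x w a} → 0 < f w → a ≤ f w → Walk G x w a → (∀ e → e < a → ¬ Walk G x w e) →
    Reach x w a
  reach 0<f a≤f W minimal = 0<f , a≤f , W , λ e V → ≮⇒≥ λ e<a → minimal e e<a V

  reach? : ∀ x y → Dec (∃ (Reach x y))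
  reach? x y with 0 <? f y | Dk-total G (f y) x y
  ... | no ¬p | _ = no λ (_ , p , _) → ¬p p
  ... | yes p | t , inj₁ (t≤f , W , minimal) =
    yes (t , reach p t≤f W minimal)
  ... | yes p | _ , inj₂ (_ , none) = no λ (t , _ , t≤f , W , _) → none t t≤f W

  -- y is a landmark reaching x for which the branching vertex of x and y, as
  -- seen from the landmark z, is farthest from z.
  record Landmarks (x : Fin n) : Set where
    constructor landmarks
    field
      {z y}   : Fin n
      {i t ℓ} : ℕ
      near    : Reach x z i
      deep    : Reach x y t
      level   : Dist G y z ℓ
      deepest : ∀ {w a k} → Reach x w a → Dist G w z k → k + t ≤ ℓ + a

  -- Twice the Gromov product d(y,z) + d(x,z) − d(x,y), which is never truncated.
  Score : Fin n → Fin n → ℕ → Fin n → ℕ → Set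
  Score x z i y k = ∃ λ t → ∃ λ ℓ → Reach x y t × Dist G y z ℓ × k + t ≡ ℓ + i

  score : ∀ {x z i y t ℓ} → Reach x z i → Reach x y t → Dist G y z ℓ → ℓ + i ∸ t + t ≡ ℓ + i
  score {i = i} {t = t} {ℓ} (_ , _ , Z , _) (_ , _ , _ , minimal) L =
    m∸n+n≡m (subst (t ≤_) (+-comm i ℓ) (minimal _ (Z ++ reverse (proj₁ L))))

  -- Distances are unique, so a `y` reaching `x` has exactly one score, which is then its largest.
  score? : ∀ {x z i} → Reach x z i → ∀ y →
    (∃ λ k → Score x z i y k × ∀ l → Score x z i y l → l ≤ k) ⊎ (∀ k → ¬ Score x z i y k)
  score? {x} {z} {i} near@(_ , _ , Z , _) y with reach? x y
  ... | no none = inj₂ λ k (t , _ , R , _) → none (t , R)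
  ... | yes (t , R@(_ , _ , Y@(W , _))) with dist G (reverse W ++ Z)
  ...   | ℓ , _ , L = inj₁ (ℓ + i ∸ t , (t , ℓ , R , L , score near R L) , unique)
    where
    unique : ∀ l → Score x z i y l → l ≤ ℓ + i ∸ t
    unique l (_ , _ , (_ , _ , Y′) , L′ , eq) with Dist-unique Y Y′ | Dist-unique L L′
    ... | refl | refl = +-cancelʳ-≤ t _ _ (≤-reflexive (trans eq (≡-sym (score near R L))))

  locate : ∀ x → Landmarks x ⊎ (∀ y t → ¬ Reach x y t)
  locate x with any? (reach? x)
  ... | no none = inj₂ λ y t R → none (y , t , R)
  ... | yes (z , i , near) with argmax (score? near)
  -- The landmark `z` is itself a candidate, with score 0.
  ...   | inj₂ none = contradiction (_ , _ , near , (here , λ _ _ → z≤n) , refl) (none z 0)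
  ...   | inj₁ (y , k , (t , ℓ , deep , L , k+t≡ℓ+i) , max) = inj₁ (landmarks near deep L deepest)
    where
    arith : ∀ a b c → a + b + c ≡ a + c + b
    arith = solve-∀
    deepest : ∀ {w a ℓ′} → Reach x w a → Dist G w z ℓ′ → ℓ′ + t ≤ ℓ + a
    -- With `i` added on both sides, the claim compares the score `ℓ′ + i ∸ a` of `w` with the
    -- maximum `k`.
    deepest {w} {a} {ℓ′} R L′ = +-cancelʳ-≤ i _ _ (begin
      ℓ′ + t + i             ≡⟨ arith ℓ′ t i ⟩
      ℓ′ + i + t             ≤⟨ +-monoˡ-≤ t (m≤n+m∸n (ℓ′ + i) a) ⟩
      a + (ℓ′ + i ∸ a) + t   ≤⟨ +-monoˡ-≤ t (+-monoʳ-≤ a (max w _ (_ , _ , R , L′ , score near R L′))) ⟩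
      a + k + t              ≡⟨ +-assoc a k t ⟩
      a + (k + t)            ≡⟨ cong (a +_) k+t≡ℓ+i ⟩
      a + (ℓ + i)            ≡⟨ +-comm a (ℓ + i) ⟩
      ℓ + i + a              ≡⟨ arith ℓ i a ⟩
      ℓ + a + i              ∎)
      where open ≤-Reasoning

  -- Two four-point conditions at `z`. For `x`, `x′`, `y` both alternatives read `r + ℓ ≤ t + i`,
  -- since `x` and `x′` have the same level `i`. For `x′`, `w`, `x` one alternative is
  -- `b + i ≤ a + i`; the other, `b + i ≤ r + k`, gives `b ≤ a` through the first condition and
  -- `deepest`.
  inseparable : ∀ {x x′ w a} (M : Landmarks x) → let open Landmarks M in
    Dist G x′ z i → Walk G x′ y t → Reach x w a → ∃ λ b → b ≤ a × Walk G x′ w b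
  inseparable {a = a} (landmarks {z} {y} {i} {t} {ℓ} (_ , _ , X) (_ , _ , Y , _) L deepest)
    X′ Y′ R@(_ , _ , W , _)
    with Rooted.four-point G acyclic z X X′ L Y (reverse Y′) | dist G (reverse W ++ proj₁ X)
  ... | r , U , le | k , _ , K with Rooted.four-point G acyclic z X′ K X (reverse U) W
  ...   | b , V , inj₂ b+i≤a+i = b , +-cancelʳ-≤ i _ _ b+i≤a+i , V
  ...   | b , V , inj₁ b+i≤r+k = b , +-cancelʳ-≤ (i + t) _ _ (begin
    b + (i + t)  ≡⟨ +-assoc b i t ⟨
    b + i + t    ≤⟨ +-monoˡ-≤ t b+i≤r+k ⟩
    r + k + t    ≡⟨ +-assoc r k t ⟩
    r + (k + t)  ≤⟨ +-monoʳ-≤ r (deepest R K) ⟩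
    r + (ℓ + a)  ≡⟨ +-assoc r ℓ a ⟨
    r + ℓ + a    ≤⟨ +-monoˡ-≤ a ([ id , id ]′ le) ⟩
    t + i + a    ≡⟨ arith t i a ⟩
    a + (i + t)  ∎) , V
    where
    open ≤-Reasoning
    arith : ∀ t i a → t + i + a ≡ a + (i + t)
    arith = solve-∀

  Separated : Fin n → Fin n → Set
  Separated x x′ = ∃ λ w → ∃ λ a → Reach x w a × (∀ b → b ≤ a → ¬ Walk G x′ w b)

  -- Of two different truncated distances the smaller is at most `f w`, so it is a true distance and
  -- `w` reaches that vertex.
  separated : ∀ {x x′} → x ≢ x′ → Separated x x′ ⊎ Separated x′ x
  separated {x} {x′} x≢x′ with resolving x x′ x≢x′
  ... | w , 0<f , a , b , a≢b , inj₂ (refl , _) , inj₂ (refl , _) = contradiction refl a≢b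
  ... | w , 0<f , a , b , a≢b , inj₁ (a≤f , W , m) , inj₂ (refl , none) =
    inj₁ (w , a , reach 0<f a≤f W m , λ e e≤a → none e (≤-trans e≤a a≤f))
  ... | w , 0<f , a , b , a≢b , inj₂ (refl , none) , inj₁ (b≤f , W , m) =
    inj₂ (w , b , reach 0<f b≤f W m , λ e e≤b → none e (≤-trans e≤b b≤f))
  ... | w , 0<f , a , b , a≢b , inj₁ (a≤f , W , m) , inj₁ (b≤f , W′ , m′) with ≤-<-connex a b
  ...   | inj₁ a≤b =
    inj₁ (w , a , reach 0<f a≤f W m , λ e e≤a → m′ e (≤-<-trans e≤a (≤∧≢⇒< a≤b a≢b)))
  ...   | inj₂ b<a =
    inj₂ (w , b , reach 0<f b≤f W′ m′ , λ e e≤b → m e (≤-<-trans e≤b b<a))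

  size : ℕ
  size = sum (tabulate (slots ∘ f))

  slot : ∀ {x y t} → Reach x y t → Fin size
  slot {y = y} (0<f , t≤f , _) = tag (slots ∘ f) y (<-slots 0<f t≤f)

  slot-injective : ∀ {x x′ y y′ t t′} (R : Reach x y t) (R′ : Reach x′ y′ t′) →
    slot R ≡ slot R′ → y ≡ y′ × t ≡ t′
  slot-injective {y = y} {y′} _ _ = tag-injective (slots ∘ f) y y′

  code : ∀ {x} → Landmarks x ⊎ (∀ y t → ¬ Reach x y t) → Fin (suc (size * size))
  code (inj₁ M) = fs (combine (slot (Landmarks.near M)) (slot (Landmarks.deep M)))
  -- Unreached vertices share one code, which is harmless: no landmark distinguishes two of them.
  code (inj₂ _) = fz

  -- An unreached `x` has no separating landmark. For reached vertices, equal codes mean equal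
  -- landmarks and distances, and `inseparable` applies.
  code-inseparable : ∀ {x x′} M M′ → code {x} M ≡ code {x′} M′ → ¬ Separated x x′
  code-inseparable (inj₂ none) _ _ (w , a , R , _) = none w a R
  code-inseparable (inj₁ M@(landmarks Z Y _ _))
    (inj₁ (landmarks Z′@(_ , _ , X′) Y′@(_ , _ , V , _) _ _)) eq (w , a , R , none)
    with combine-injective _ _ _ _ (fs-injective eq)
  ... | eq₁ , eq₂ with slot-injective Z Z′ eq₁ | slot-injective Y Y′ eq₂
  ...   | refl , refl | refl , refl with inseparable M X′ V R
  ...     | b , b≤a , W = none b b≤a W

  code-injective : Injective _≡_ _≡_ (λ x → code (locate x))
  code-injective {x} {x′} eq with x ≟ᶠ x′
  ... | yes x≡x′ = x≡x′
  ... | no x≢x′ with separated x≢x′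
  ...   | inj₁ s = contradiction s (code-inseparable (locate x) (locate x′) eq)
  ...   | inj₂ s = contradiction s (code-inseparable (locate x′) (locate x) (≡-sym eq))

  order-bound : 2 ≤ n → n ≤ 5 * (cost f * cost f)
  order-bound 2≤n = begin
    n                                       ≤⟨ injective⇒≤ code-injective ⟩
    -- The 1 is absorbed into `b * b`: two distinct vertices force a positive value, hence `1 ≤ b`.
    1 + size * size                         ≤⟨ +-mono-≤ (*-mono-≤ 1≤b 1≤b) (*-mono-≤ size≤2b size≤2b) ⟩
    b * b + 2 * b * (2 * b)                 ≡⟨ arith b ⟩
    5 * (b * b)                             ∎
    where
    open ≤-Reasoning
    b : ℕ
    b = cost f
    0<cost : 2 ≤ n → 0 < cost f
    0<cost (s≤s (s≤s _)) with resolving fz (fs fz) (λ ())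
    ... | z , 0<f , _ = ≤-trans 0<f (≤-cost f z)
    1≤b : 1 ≤ b
    1≤b = 0<cost 2≤n
    size≤2b : size ≤ 2 * b
    size≤2b = subst (λ c → size ≤ 2 * c) (≡-sym (cost-tabulate f)) (sum-slots-≤ f)
    arith : ∀ b → b * b + 2 * b * (2 * b) ≡ 5 * (b * b)
    arith = solve-∀

-- Existence of the broadcast dimension by finite search

bounded? : ∀ {n} {P : (Fin n → ℕ) → Set} → (∀ {f g} → f ≗ g → P f → P g) →
  (∀ f → Dec (P f)) → ∀ c → Dec (∃ λ f → (∀ i → f i ≤ c) × P f)
bounded? {zero} resp P? c =
  map′ (λ p → none , (λ ()) , p) (λ (_ , _ , p) → resp (λ ()) p) (P? none)
  where
  none : Fin 0 → ℕ
  none ()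
bounded? {suc n} {P} resp P? c = map′ to from
  (anyUpTo? (λ v → bounded? {P = P ∘ (v ∷_)} (resp ∘ ∷-cong v) (P? ∘ (v ∷_)) c) (suc c))
  where
  ∷-cong : ∀ v {f g : Fin n → ℕ} → f ≗ g → (v ∷ f) ≗ (v ∷ g)
  ∷-cong v eq fz     = refl
  ∷-cong v eq (fs i) = eq i
  to : _ → _
  to (v , v<1+c , f , f≤c , p) = v ∷ f , (λ { fz → s≤s⁻¹ v<1+c ; (fs i) → f≤c i }) , p
  from : ∃ (λ f → (∀ i → f i ≤ c) × P f) → _
  -- `head f ∷ tail f` agrees with `f` pointwise, which is why `P` has to respect `_≗_`.
  from (f , f≤c , p) = head f , s≤s (f≤c fz) , tail f , f≤c ∘ fs ,
    resp (λ { fz → refl ; (fs i) → refl }) p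

module _ {n} (G : SimpleGraph n) where

  Resolving? : ∀ f → Dec (Resolving G f)
  Resolving? f = all? λ x → all? λ y → ¬? (x ≟ᶠ y) →-dec any? λ z → (0 <? f z) ×-dec distinct? x y z
    where
    distinct? : ∀ x y z → Dec (Σ ℕ λ a → Σ ℕ λ b → a ≢ b × Dk G (f z) x z a × Dk G (f z) y z b)
    distinct? x y z with Dk-total G (f z) x z | Dk-total G (f z) y z
    ... | a , D | b , E with a ≟ b
    ...   | no a≢b   = yes (a , b , a≢b , D , E)
    ...   | yes refl = no λ (_ , _ , a≢b , D′ , E′) →
      a≢b (trans (Dk-unique G D′ D) (Dk-unique G E E′))

  Resolving-cong : ∀ {f g : Broadcast n} → f ≗ g → Resolving G f → Resolving G g
  Resolving-cong eq res x y x≢y with res x y x≢y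
  ... | z , r rewrite eq z = z , r

  -- A broadcast of cost `c` has all values at most `c`, so whether `c` is the cost of a resolving
  -- broadcast is a finite question; the least such `c` is the dimension.
  bdim-exists : ∀ f → Resolving G f → ∃ λ b → b ≤ cost f × IsBdim G b
  bdim-exists f res with least attained? (cost f) (f , res , refl)
    where
    attained? : ∀ c → Dec (∃ λ g → Resolving G g × cost g ≡ c)
    attained? c = map′ (λ (g , _ , r) → g , r)
      (λ { (g , r , refl) → g , ≤-cost g , r , refl })
      (bounded? (λ eq (r , e) → Resolving-cong eq r , trans (cong sum (map-cong (≡-sym ∘ eq) (allFin n))) e)
        (λ g → Resolving? g ×-dec (cost g ≟ c)) c)
  ... | b , b≤c , attained , minimal = b , b≤c , attained , λ g r → minimal (cost g) (g , r , refl)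

  -- Following `descend` yields a walk of length `ψ u`; the Lipschitz condition shows that no walk
  -- is shorter.
  Dist-potential : ∀ {z} (ψ : Fin n → ℕ) → ψ z ≡ 0 →
    (∀ {u v} → adj G u v ≡ true → ψ u ≤ suc (ψ v)) →
    (∀ u → u ≡ z ⊎ ∃ λ v → adj G u v ≡ true × ψ u ≡ suc (ψ v)) →
    ∀ u → Dist G u z (ψ u)
  Dist-potential {z} ψ ψz lipschitz descend u = walk (ψ u) u refl , λ _ → lower
    where
    walk : ∀ d u → ψ u ≡ d → Walk G u z d
    walk d u eq with descend u
    walk d u eq | inj₁ refl rewrite trans (≡-sym eq) ψz = here
    walk (suc d) u eq | inj₂ (v , e , eq′) = step e (walk d v (suc-injective (trans (≡-sym eq′) eq)))
    walk zero u eq | inj₂ (v , e , eq′) = contradiction (trans (≡-sym eq) eq′) λ ()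
    lower : ∀ {u ℓ} → Walk G u z ℓ → ψ u ≤ ℓ
    lower here       = ≤-reflexive ψz
    lower (step e W) = ≤-trans (lipschitz e) (s≤s (lower W))

-- Forests given by a parent relation and a depth

module Forest {n} {_↘_ : Fin n → Fin n → Set}
  (_↘?_ : ∀ u v → Dec (u ↘ v)) (depth : Fin n → ℕ)
  (depth-↘ : ∀ {u v} → u ↘ v → depth u ≡ suc (depth v))
  (parent-unique : ∀ {u v w} → u ↘ v → u ↘ w → v ≡ w) where

  forest : SimpleGraph n
  forest .adj u v = does (u ↘? v) ∨ does (v ↘? u)
  forest .sym u v = Bool.∨-comm (does (u ↘? v)) (does (v ↘? u))
  forest .irrefl v = cong (λ b → b ∨ b) (dec-false (v ↘? v) λ r → 1+n≢n (≡-sym (depth-↘ r)))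

  edge : ∀ {u v} → adj forest u v ≡ true → u ↘ v ⊎ v ↘ u
  edge {u} {v} e with u ↘? v | v ↘? u
  ... | yes r | _     = inj₁ r
  ... | no _  | yes r = inj₂ r
  edge () | no _ | no _

  edge-up : ∀ {u v} → u ↘ v → adj forest u v ≡ true
  edge-up {u} {v} r = cong (_∨ does (v ↘? u)) (dec-true (u ↘? v) r)

  edge-down : ∀ {u v} → v ↘ u → adj forest u v ≡ true
  edge-down {u} {v} r = trans (sym forest u v) (edge-up r)

  -- A deepest vertex of a cycle would have both its neighbours as parents.
  forest-acyclic : Acyclic forest
  forest-acyclic (m , c , injective , linked , closing)
    with argmax {P = λ i k → k ≡ depth (c i)} (λ i → inj₁ (_ , refl , λ l → ≤-reflexive))
  ... | inj₂ none = none fz _ refl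
  ... | inj₁ (i , _ , refl , deepest) with neighbours i
    where
    neighbours : ∀ i → ∃ λ p → ∃ λ q → p ≢ q ×
      adj forest (c i) (c p) ≡ true × adj forest (c i) (c q) ≡ true
    neighbours fz = fs fz , fromℕ _ , (λ ()) , linked fz , adj-sym forest closing
    neighbours (fs i) with view i
    ... | ‵fromℕ = inject₁ i , fz , (λ ()) , adj-sym forest (linked i) , closing
    ... | ‵inj₁ {i = j} _ = inject₁ (inject₁ j) , fs (fs j) , distinct ,
      adj-sym forest (linked (inject₁ j)) , linked (fs j)
      where
      distinct : inject₁ (inject₁ j) ≢ fs (fs j)
      distinct eq = <⇒≢ (m<n⇒m<1+n (n<1+n (toℕ j)))
        (trans (≡-sym (trans (toℕ-inject₁ (inject₁ j)) (toℕ-inject₁ j))) (cong toℕ eq))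
  ...   | p , q , p≢q , e , e′ = p≢q (injective (parent-unique (parent p e) (parent q e′)))
    where
    parent : ∀ p → adj forest (c i) (c p) ≡ true → c i ↘ c p
    parent p e with edge e
    ... | inj₁ r = r
    ... | inj₂ r = contradiction (deepest p _ refl) (<⇒≱ (≤-reflexive (≡-sym (depth-↘ r))))

-- Sums after an increase at one index

sum-const-0 : ∀ n → sum (tabulate {n = n} λ _ → 0) ≡ 0
sum-const-0 zero    = refl
sum-const-0 (suc n) = sum-const-0 n

sum-updateAt-+ : ∀ {n} (f : Fin n → ℕ) i v →
  sum (tabulate (updateAt f i (v +_))) ≡ v + sum (tabulate f)
sum-updateAt-+ f fz     v = +-assoc v (f fz) _
sum-updateAt-+ f (fs i) v rewrite sum-updateAt-+ (f ∘ fs) i v = begin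
  f fz + (v + s) ≡⟨ +-assoc (f fz) v s ⟨
  f fz + v + s   ≡⟨ cong (_+ s) (+-comm (f fz) v) ⟩
  v + f fz + s   ≡⟨ +-assoc v (f fz) s ⟩
  v + (f fz + s) ∎
  where
  open ≡-Reasoning
  s : ℕ
  s = sum (tabulate (f ∘ fs))

updateAt-+-≥ : ∀ {n} (f : Fin n → ℕ) i v → v ≤ updateAt f i (v +_) i
updateAt-+-≥ f fz     v = m≤m+n v _
updateAt-+-≥ f (fs i) v = updateAt-+-≥ (f ∘ fs) i v

updateAt-+-increasing : ∀ {n} (f : Fin n → ℕ) i v j → f j ≤ updateAt f i (v +_) j
updateAt-+-increasing f fz     v fz     = m≤n+m _ v
updateAt-+-increasing f fz     v (fs j) = ≤-refl
updateAt-+-increasing f (fs i) v fz     = ≤-refl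
updateAt-+-increasing f (fs i) v (fs j) = updateAt-+-increasing (f ∘ fs) i v j

-- The comb and its resolving broadcast

-- Vertex (j , h) has height h on the tooth planted at place j of the spine;
-- Step j h j′ h′ says that (j′ , h′) is the next vertex from (j , h) to (0 , 0).
data Step : ℕ → ℕ → ℕ → ℕ → Set where
  tooth : ∀ {j h} → Step j (suc h) j h
  spine : ∀ {j} → Step (suc j) 0 j 0

Step? : ∀ j h j′ h′ → Dec (Step j h j′ h′)
Step? j (suc h) j′ h′ =
  map′ (λ { (refl , refl) → tooth }) (λ { tooth → refl , refl }) ((j ≟ j′) ×-dec (h ≟ h′))
Step? (suc j) zero j′ h′ =
  map′ (λ { (refl , refl) → spine }) (λ { spine → refl , refl }) ((j ≟ j′) ×-dec (0 ≟ h′))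
Step? zero zero j′ h′ = no λ ()

Step-unique : ∀ {j h k i k′ i′} → Step j h k i → Step j h k′ i′ → k ≡ k′ × i ≡ i′
Step-unique tooth tooth = refl , refl
Step-unique spine spine = refl , refl

Step-depth : ∀ {j h k i} → Step j h k i → j + h ≡ suc (k + i)
Step-depth {j} tooth = +-suc j _
Step-depth spine = refl

module Comb (m : ℕ) where

  L : ℕ
  L = suc m

  V : Set
  V = Fin (L * L)

  -- Unfolding remQuot would hide u in col u from unification.
  abstract
    col row : V → ℕ
    col u = toℕ (proj₁ (remQuot {L} L u))
    row u = toℕ (proj₂ (remQuot {L} L u))

    col≤m : ∀ u → col u ≤ m
    col≤m u = s≤s⁻¹ (toℕ<n (proj₁ (remQuot {L} L u)))

    row≤m : ∀ u → row u ≤ m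
    row≤m u = s≤s⁻¹ (toℕ<n (proj₂ (remQuot {L} L u)))

    position-injective : ∀ {u v} → col u ≡ col v → row u ≡ row v → u ≡ v
    position-injective {u} {v} eq eq′ = begin
      u                                      ≡⟨ combine-remQuot {L} L u ⟨
      uncurry combine (remQuot {L} L u)      ≡⟨ cong₂ combine (toℕ-injective eq) (toℕ-injective eq′) ⟩
      uncurry combine (remQuot {L} L v)      ≡⟨ combine-remQuot {L} L v ⟩
      v                                      ∎
      where open ≡-Reasoning

    place : ∀ {j h} → j ≤ m → h ≤ m → ∃ λ v → col v ≡ j × row v ≡ h
    place j≤m h≤m = combine j h ,
      trans (cong (toℕ ∘ proj₁) (remQuot-combine j h)) (toℕ-fromℕ< _) ,
      trans (cong (toℕ ∘ proj₂) (remQuot-combine j h)) (toℕ-fromℕ< _)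
      where
      j h : Fin L
      j = fromℕ< (s≤s j≤m)
      h = fromℕ< (s≤s h≤m)

  _↘_ : V → V → Set
  u ↘ v = Step (col u) (row u) (col v) (row v)

  open Forest {_↘_ = _↘_}
    (λ u v → Step? (col u) (row u) (col v) (row v)) (λ u → col u + row u) Step-depth
    (λ r r′ → uncurry position-injective (Step-unique r r′)) public

  step-at : ∀ {u v j h j′ h′} → Step j h j′ h′ →
    col u ≡ j → row u ≡ h → col v ≡ j′ → row v ≡ h′ → u ↘ v
  step-at r refl refl refl refl = r

  neighbour : ∀ {u j h j′ h′} → Step j h j′ h′ ⊎ Step j′ h′ j h → col u ≡ j → row u ≡ h →
    j′ ≤ m → h′ ≤ m → ∃ λ v → adj forest u v ≡ true × col v ≡ j′ × row v ≡ h′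
  neighbour {u} (inj₁ s) c r j′≤m h′≤m with place j′≤m h′≤m
  ... | v , c′ , r′ = v , edge-up {u} {v} (step-at s c r c′ r′) , c′ , r′
  neighbour {u} (inj₂ s) c r j′≤m h′≤m with place j′≤m h′≤m
  ... | v , c′ , r′ = v , edge-down {u} {v} (step-at s c′ r′ c r) , c′ , r′

  module Potential (g : ℕ → ℕ → ℕ)
    (g-lipschitz : ∀ {j h j′ h′} → Step j h j′ h′ → g j h ≤ suc (g j′ h′) × g j′ h′ ≤ suc (g j h))
    where

    potential : V → ℕ
    potential u = g (col u) (row u)

    lipschitz : ∀ {u v} → adj forest u v ≡ true → potential u ≤ suc (potential v)
    lipschitz {u} {v} e with edge {u} {v} e
    ... | inj₁ r = proj₁ (g-lipschitz r)
    ... | inj₂ r = proj₂ (g-lipschitz r)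

    descend : ∀ {u j h j′ h′} → Step j h j′ h′ ⊎ Step j′ h′ j h → col u ≡ j → row u ≡ h →
      j′ ≤ m → h′ ≤ m → g j h ≡ suc (g j′ h′) →
      ∃ λ v → adj forest u v ≡ true × potential u ≡ suc (potential v)
    descend s c r j′≤m h′≤m eq with neighbour s c r j′≤m h′≤m
    ... | v , e , c′ , r′ = v , e , trans (cong₂ g c r) (trans eq (≡-sym (cong suc (cong₂ g c′ r′))))

  left right : V
  left  = proj₁ (place z≤n z≤n)
  right = proj₁ (place ≤-refl z≤n)

  left-position : col left ≡ 0 × row left ≡ 0
  left-position = proj₂ (place z≤n z≤n)

  right-position : col right ≡ m × row right ≡ 0
  right-position = proj₂ (place ≤-refl z≤n)

  from-left from-right : ℕ → ℕ → ℕ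
  from-left  j h = j + h
  from-right j h = m ∸ j + h

  Dist-left : ∀ u → Dist forest u left (from-left (col u) (row u))
  Dist-left = Dist-potential forest potential
    (cong₂ from-left (proj₁ left-position) (proj₂ left-position)) lipschitz
    λ u → towards u (col u) (row u) refl refl
    where
    open Potential from-left (λ s → ≤-reflexive (Step-depth s) ,
      m≤n⇒m≤1+n (≤-trans (n≤1+n _) (≤-reflexive (≡-sym (Step-depth s)))))
    towards : ∀ u j h → col u ≡ j → row u ≡ h →
      u ≡ left ⊎ ∃ λ v → adj forest u v ≡ true × potential u ≡ suc (potential v)
    towards u j (suc h) c r = inj₂ (descend (inj₁ tooth) c r
      (subst (_≤ m) c (col≤m u)) (≤-trans (n≤1+n h) (subst (_≤ m) r (row≤m u))) (+-suc j h))
    towards u (suc j) zero c r = inj₂ (descend (inj₁ spine) c r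
      (≤-trans (n≤1+n j) (subst (_≤ m) c (col≤m u))) z≤n refl)
    towards u zero zero c r = inj₁ (position-injective
      (trans c (≡-sym (proj₁ left-position))) (trans r (≡-sym (proj₂ left-position))))

  Dist-right : ∀ u → Dist forest u right (from-right (col u) (row u))
  Dist-right = Dist-potential forest potential
    (trans (cong₂ from-right (proj₁ right-position) (proj₂ right-position)) (cong (_+ 0) (n∸n≡0 m)))
    lipschitz
    λ u → towards u (col u) (row u) refl refl
    where
    from-right-lipschitz : ∀ {j h j′ h′} → Step j h j′ h′ →
      from-right j h ≤ suc (from-right j′ h′) × from-right j′ h′ ≤ suc (from-right j h)
    from-right-lipschitz {j} (tooth {h = h}) =
      ≤-reflexive (+-suc (m ∸ j) h) , m≤n⇒m≤1+n (+-monoʳ-≤ (m ∸ j) (n≤1+n h))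
    from-right-lipschitz (spine {j}) =
      m≤n⇒m≤1+n (+-monoˡ-≤ 0 (∸-monoʳ-≤ m (n≤1+n j))) ,
      +-monoˡ-≤ 0 (m∸n≤1+m∸1+n m j)
      where
      m∸n≤1+m∸1+n : ∀ m n → m ∸ n ≤ suc (m ∸ suc n)
      m∸n≤1+m∸1+n zero    zero    = z≤n
      m∸n≤1+m∸1+n zero    (suc n) = z≤n
      m∸n≤1+m∸1+n (suc m) zero    = ≤-refl
      m∸n≤1+m∸1+n (suc m) (suc n) = m∸n≤1+m∸1+n m n
    open Potential from-right from-right-lipschitz
    towards : ∀ u j h → col u ≡ j → row u ≡ h →
      u ≡ right ⊎ ∃ λ v → adj forest u v ≡ true × potential u ≡ suc (potential v)
    towards u j (suc h) c r = inj₂ (descend (inj₁ tooth) c r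
      (subst (_≤ m) c (col≤m u)) (≤-trans (n≤1+n h) (subst (_≤ m) r (row≤m u))) (+-suc (m ∸ j) h))
    towards u j zero c r with m≤n⇒m<n∨m≡n (subst (_≤ m) c (col≤m u))
    -- Towards the right end the spine is followed against `Step`, from `j` to `suc j`.
    ... | inj₁ j<m  = inj₂ (descend (inj₂ spine) c r j<m z≤n (cong (_+ 0) (+-∸-assoc 1 j<m)))
    ... | inj₂ refl = inj₁ (position-injective
      (trans c (≡-sym (proj₁ right-position))) (trans r (≡-sym (proj₂ right-position))))

  -- The values are added rather than overwritten, so the cost is `4 * L` also for `m = 0`, where
  -- both ends are the same vertex.
  broadcast : Broadcast (L * L)
  broadcast = updateAt (updateAt (λ _ → 0) left (2 * L +_)) right (2 * L +_)

  cost-broadcast : cost broadcast ≡ 4 * L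
  cost-broadcast = begin
    cost broadcast                        ≡⟨ cost-tabulate broadcast ⟩
    sum (tabulate broadcast)              ≡⟨ sum-updateAt-+ _ right _ ⟩
    2 * L + sum (tabulate (updateAt (λ _ → 0) left (2 * L +_)))
                                          ≡⟨ cong (2 * L +_) (sum-updateAt-+ _ left _) ⟩
    2 * L + (2 * L + sum (tabulate {n = L * L} λ _ → 0))
                                          ≡⟨ cong (λ s → 2 * L + (2 * L + s)) (sum-const-0 (L * L)) ⟩
    2 * L + (2 * L + 0)                   ≡⟨ arith L ⟩
    4 * L                                 ∎
    where
    open ≡-Reasoning
    arith : ∀ l → 2 * l + (2 * l + 0) ≡ 4 * l
    arith = solve-∀

  reach-left : 2 * L ≤ broadcast left
  reach-left = ≤-trans (updateAt-+-≥ _ left _) (updateAt-+-increasing _ right _ left)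

  reach-right : 2 * L ≤ broadcast right
  reach-right = updateAt-+-≥ _ right _

  -- All distances to `z` are at most `2 * m`, below its value, so none of them is truncated.
  separate : ∀ {z} {d : V → ℕ} → (∀ u → Dist forest u z (d u)) → (∀ u → d u ≤ m + m) →
    2 * L ≤ broadcast z → ∀ {x y} → d x ≢ d y →
    Σ V λ z → 0 < broadcast z × Σ ℕ λ a → Σ ℕ λ b →
      a ≢ b × Dk forest (broadcast z) x z a × Dk forest (broadcast z) y z b
  separate {z} {d} D d≤2m 2L≤fz {x} {y} dx≢dy =
    z , ≤-trans (s≤s z≤n) 2L≤fz , d x , d y , dx≢dy , near x , near y
    where
    2m≤2L : m + m ≤ 2 * L
    2m≤2L = +-mono-≤ (n≤1+n m) (≤-trans (n≤1+n m) (m≤m+n L 0))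
    near : ∀ u → Dk forest (broadcast z) u z (d u)
    near u = inj₁ (≤-trans (d≤2m u) (≤-trans 2m≤2L 2L≤fz) , proj₁ (D u) ,
      λ b b<d W → <⇒≱ b<d (proj₂ (D u) b W))

  -- The two distances add up to `2 * row u + m`, which determines the row; the distance to the left
  -- end then determines the column.
  broadcast-resolving : Resolving forest broadcast
  broadcast-resolving x y x≢y with from-left (col x) (row x) ≟ from-left (col y) (row y)
                         | from-right (col x) (row x) ≟ from-right (col y) (row y)
  ... | no l≢ | _ = separate Dist-left (λ u → +-mono-≤ (col≤m u) (row≤m u)) reach-left l≢
  ... | _ | no r≢ = separate Dist-right (λ u → +-mono-≤ (m∸n≤m m (col u)) (row≤m u)) reach-right r≢
  ... | yes l≡ | yes r≡ = contradiction (position-injective col≡ row≡) x≢y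
    where
    open ≡-Reasoning
    arith : ∀ j h i → j + h + (i + h) ≡ 2 * h + (j + i)
    arith = solve-∀
    total : ∀ u → from-left (col u) (row u) + from-right (col u) (row u) ≡ 2 * row u + m
    total u = trans (arith (col u) (row u) (m ∸ col u)) (cong (2 * row u +_) (m+[n∸m]≡n (col≤m u)))
    row≡ : row x ≡ row y
    row≡ = *-cancelˡ-≡ _ _ 2 (+-cancelʳ-≡ m _ _
      (trans (≡-sym (total x)) (trans (cong₂ _+_ l≡ r≡) (total y))))
    col≡ : col x ≡ col y
    col≡ = +-cancelʳ-≡ (row x) _ _ (trans l≡ (cong (col y +_) (≡-sym row≡)))

-- Both bounds with explicit constants

theorem1p3 : (Σ ℕ λ K → ∀ (n : ℕ) (G : SimpleGraph n) → Acyclic G → 2 ≤ n →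
    ∀ (b : ℕ) → IsBdim G b → n ≤ K * (b * b))
    × (Σ ℕ λ C → ∀ (N : ℕ) → Σ ℕ λ n → N ≤ n × Σ (SimpleGraph n) λ G →
    Acyclic G × Σ ℕ λ b → IsBdim G b × b * b ≤ C * n)
-- The 5 comes from `order-bound`; the 16 is the square of the 4 in the cost `4 * L` of a comb of
-- order `L * L`.
theorem1p3 = (5 , lower) , (16 , upper)
  where
  lower : ∀ (n : ℕ) (G : SimpleGraph n) → Acyclic G → 2 ≤ n →
    ∀ (b : ℕ) → IsBdim G b → n ≤ 5 * (b * b)
  lower n G acyclic 2≤n b ((f , resolving , refl) , _) =
    LowerBound.order-bound G acyclic f resolving 2≤n
  upper : ∀ (N : ℕ) → Σ ℕ λ n → N ≤ n × Σ (SimpleGraph n) λ G →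
    Acyclic G × Σ ℕ λ b → IsBdim G b × b * b ≤ 16 * n
  upper N = order , ≤-trans (n≤1+n N) (m≤m*n (suc N) (suc N)) , forest , forest-acyclic , from attained
    where
    open Comb N
    order : ℕ
    order = suc N * suc N
    attained : ∃ λ b → b ≤ cost broadcast × IsBdim forest b
    attained = bdim-exists forest broadcast broadcast-resolving
    from : (∃ λ b → b ≤ cost broadcast × IsBdim forest b) →
      Σ ℕ λ b → IsBdim forest b × b * b ≤ 16 * order
    from (b , b≤cost , isBdim) =
      b , isBdim , ≤-trans (*-mono-≤ b≤4L b≤4L) (≤-reflexive (arith (suc N)))
      where
      b≤4L : b ≤ 4 * suc N
      b≤4L = subst (b ≤_) cost-broadcast b≤cost
      arith : ∀ l → 4 * l * (4 * l) ≡ 16 * (l * l)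
      arith = solve-∀
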